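{- With $(y)_n$ denoting the number of permutations in $F_n(321,1423)$ with label $(y)$, the following hold. (i) For all $n\ge 2$, $(1)_n=F_n-n+1$. (ii) For all $n\ge 3$, $(2b)_n=n-3$. (iii) For all $n\ge 3$, $(2c)_n=1$. (iv) For all $n\ge 0$, $(2d)_n=F_{n+1}-n-1$. (v) For all $n\ge 2$, $(3)_n=1$. (vi) For all $n\ge 0$, $|F_n(321,1423)|=F_{n+2}-n-1$.
   Context: $F_n$ (without arguments) is the Fibonacci number with $F_0=F_1=1$ and $F_n=F_{n-1}+F_{n-2}$ for $n\ge2$. A Fishburn permutation is a permutation $\pi$ (in one-line notation) with no subsequence $\pi_j,\pi_{j+1},\pi_k$ such that $j+1<k$, $\pi_j=\pi_k+1$, and $\pi_{j+1}>\pi_j$. $F_n(321,1423)$ is the set of Fishburn permutations of length $n$ avoiding the classical patterns $321$ and $1423$ (i.e. having no subsequence with the same relative order as either). A descent of $\pi$ is a pair of adjacent entries $\pi_j>\pi_{j+1}$. Labels: for $n\ge1$, a permutation $\pi\in F_n(321,1423)$ has label (1) if $n\ge2$, $\pi_{n-1}=n$ and $\pi_n=n-1$; (2a) if $\pi=1$; (2b) if $n\ge4$, $\pi_{n-1}=n$ and $\pi_n=k$ where $1<k<n-1$; (2c) if $n\ge3$ and the rightmost $k+2$ entries of $\pi$ are $n,1,2,\ldots,k,n-1$ for some $k$ with $1\le k\le n-2$; (2d) if $\pi_n=n$ and $\pi$ has a descent; (3) if $n\ge2$ and $\pi$ has no descents. The empty permutation has none of these labels. -}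

module Defs where

open import Data.Fin using (Fin) renaming (_<_ to _<ᶠ_)
open import Data.Integer using (ℤ; +_)
open import Data.List using (List; []; _∷_; _++_; length; lookup; map; upTo)
open import Data.List.Membership.Propositional using (_∈_)
open import Data.List.Relation.Binary.Permutation.Propositional using (_↭_)
open import Data.List.Relation.Unary.Unique.Propositional using (Unique)
open import Data.Nat using (ℕ; zero; suc; _+_; _∸_; _≤_; _<_)
open import Data.Product using (Σ; _×_; ∃-syntax)
open import Function.Bundles using (_⇔_)
open import Relation.Binary.PropositionalEquality using (_≡_)
open import Relation.Nullary using (¬_)

-- Fibonacci numbers, with F 0 = F 1 = 1.
F : ℕ → ℕ
F zero          = 1
F (suc zero)    = 1
F (suc (suc n)) = F (suc n) + F n

-- A permutation of length n is given by its one-line notation, a list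
-- in which each of 1, …, n occurs exactly once.
IsPermutation : ℕ → List ℕ → Set
IsPermutation n π = π ↭ map suc (upTo n)

-- f picks the positions of a subsequence of π with the same relative
-- order as p.
Contains : List ℕ → List ℕ → Set
Contains π p =
  Σ (Fin (length p) → Fin (length π)) λ f →
    (∀ i j → i <ᶠ j → f i <ᶠ f j) ×
    (∀ i j → lookup π (f i) < lookup π (f j) ⇔ lookup p i < lookup p j)

Avoids : List ℕ → List ℕ → Set
Avoids π p = ¬ Contains π p

-- The entries a , b , c are π_j , π_{j+1} , π_k with j + 1 < k.
IsFishburn : List ℕ → Set
IsFishburn π =
  ¬ (∃[ ρ ] ∃[ a ] ∃[ b ] ∃[ τ ] ∃[ c ]
       π ≡ ρ ++ a ∷ b ∷ τ × c ∈ τ × a ≡ c + 1 × a < b)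

-- Membership of π in F_n(321,1423).
InF : ℕ → List ℕ → Set
InF n π =
  IsPermutation n π ×
  IsFishburn π ×
  Avoids π (3 ∷ 2 ∷ 1 ∷ []) ×
  Avoids π (1 ∷ 4 ∷ 2 ∷ 3 ∷ [])

HasDescent : List ℕ → Set
HasDescent π = ∃[ ρ ] ∃[ a ] ∃[ b ] ∃[ τ ] π ≡ ρ ++ a ∷ b ∷ τ × b < a

data Label : Set where
  ⟨1⟩ ⟨2a⟩ ⟨2b⟩ ⟨2c⟩ ⟨2d⟩ ⟨3⟩ : Label

-- The conditions for a permutation π of length n to have a given label.
-- The truncated subtractions n ∸ 1 and n ∸ 2 occur only beside bounds on
-- n that make them exact.  No label holds when n = 0 and π = [].
HasLabel : Label → ℕ → List ℕ → Set
HasLabel ⟨1⟩  n π = 2 ≤ n × (∃[ ρ ] π ≡ ρ ++ n ∷ (n ∸ 1) ∷ [])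
HasLabel ⟨2a⟩ n π = π ≡ 1 ∷ []
HasLabel ⟨2b⟩ n π =
  4 ≤ n × (∃[ ρ ] ∃[ k ] 1 < k × k < n ∸ 1 × π ≡ ρ ++ n ∷ k ∷ [])
HasLabel ⟨2c⟩ n π =
  3 ≤ n ×
  (∃[ ρ ] ∃[ k ] 1 ≤ k × k ≤ n ∸ 2 ×
     π ≡ ρ ++ (n ∷ map suc (upTo k)) ++ (n ∸ 1) ∷ [])
HasLabel ⟨2d⟩ n π = (∃[ ρ ] π ≡ ρ ++ n ∷ []) × HasDescent π
HasLabel ⟨3⟩  n π = 2 ≤ n × ¬ HasDescent π

-- Membership in the set of elements of F_n(321,1423) with label y.
Labelled : Label → ℕ → List ℕ → Set
Labelled y n π = InF n π × HasLabel y n π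

-- P holds of exactly z lists: they can be listed without repetition by a
-- list of length z.  The integer z allows for subtraction in formulas.
infix 4 #_≐_

#_≐_ : (List ℕ → Set) → ℤ → Set
# P ≐ z =
  ∃[ πs ] Unique πs × (∀ π → π ∈ πs ⇔ P π) × + length πs ≡ z

{-# OPTIONS --safe #-}

-- Let k be the last entry of a permutation π in F_n(321,1423), n ≥ 2.  If k < n,
-- consider the entry b after k + 1.  Either b = k, and 321-avoidance forces k + 1 = n;
-- or the Fishburn condition gives b < k.  In the latter case nothing precedes k + 1,
-- and the entries strictly between k + 1 and k are increasing, so that π is
-- k+1, 1, …, k−1, k+2, …, n, k.  Hence π is σ n or σ n (n−1) with σ a shorter element
-- of the family, or one of n − 2 exceptional permutations, one for each k with
-- 2 ≤ k ≤ n − 1, and f(n) = f(n−1) + f(n−2) + n − 2 for the cardinalities f.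

module Submission where

open import Defs
open import Data.Empty using (⊥-elim)
open import Data.Fin as Fin using (Fin; zero; suc; toℕ)
open import Data.Integer using (+_; _+_; _-_)
open import Data.Integer.Tactic.RingSolver renaming (solve-∀ to ℤ-solve-∀)
open import Data.List as List
  using (List; []; _∷_; [_]; _++_; _∷ʳ_; length; lookup; map; tabulate; upTo; applyUpTo; drop)
open import Data.List.Membership.Propositional using (_∈_; _∉_)
open import Data.List.Membership.Propositional.Properties
  using (∈-lookup; ∈-++⁺ˡ; ∈-++⁺ʳ; ∈-++⁻; ∈-map⁺; ∈-map⁻; ∈-upTo⁺; ∈-upTo⁻;
         ∈-applyUpTo⁻; ∈-insert; ∈-∃++)
open import Data.List.Properties
  using (∷-injectiveʳ; ++-cancelʳ; ++-assoc; ++-identityʳ; ∷ʳ-injective; ∷ʳ-injectiveˡ; ∷ʳ-injectiveʳ;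
         upTo-∷ʳ; applyUpTo-∷ʳ; map-++; length-++; length-map; length-upTo)
open import Data.List.Relation.Binary.Disjoint.Propositional using (Disjoint)
open import Data.List.Relation.Binary.Equality.Propositional using (≋⇒≡)
open import Data.List.Relation.Binary.Permutation.Propositional
  using (_↭_; ↭-sym; ↭-trans; ↭-reflexive; ↭-refl; ↭-swap; ↭⇒↭ₛ)
open import Data.List.Relation.Binary.Permutation.Propositional.Properties
  using (∈-resp-↭; drop-∷; ↭-empty-inv; ↭-singleton-inv; ∷↭∷ʳ; ++⁺ʳ; ++⁺ˡ)
import Data.List.Relation.Binary.Permutation.Setoid.Properties as Permutationₛ
open import Data.List.Relation.Binary.Sublist.Propositional
  using (_⊆_; []; _∷_; minimum; ⊆-refl; ⊆-trans; from∈; to∈) renaming (_∷ʳ_ to skip)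
import Data.List.Relation.Binary.Sublist.Propositional as Sublist
import Data.List.Relation.Binary.Sublist.Propositional.Properties as Sublistₚ
open import Data.List.Relation.Unary.All as All using (All; []; _∷_)
import Data.List.Relation.Unary.All.Properties as Allₚ
open import Data.List.Relation.Unary.AllPairs as AllPairs using (AllPairs; []; _∷_)
import Data.List.Relation.Unary.AllPairs.Properties as AllPairsₚ
open import Data.List.Relation.Unary.Any using (here; there)
open import Data.List.Relation.Unary.Sorted.TotalOrder.Properties using (AllPairs⇒Sorted; ↗↭↗⇒≋)
open import Data.List.Relation.Unary.Unique.Propositional using (Unique)
import Data.List.Relation.Unary.Unique.Propositional.Properties as Uniqueₚ
open import Data.Nat as ℕ using (ℕ; zero; suc; _≤_; _<_; z≤n; s≤s; _∸_)
open import Data.Nat.Induction using (<-rec)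
open import Data.Nat.Properties
open import Data.Nat.Tactic.RingSolver renaming (solve-∀ to ℕ-solve-∀)
open import Data.Product using (Σ; ∃-syntax; _×_; _,_; proj₁; proj₂)
open import Data.Sum using (_⊎_; inj₁; inj₂; [_,_]′)
open import Function using (_∘_; id; _⇔_; mk⇔; Equivalence)
open import Level using (0ℓ)
open import Relation.Binary using (Rel; tri<; tri≈; tri>)
open import Relation.Binary.PropositionalEquality
  using (_≡_; _≢_; refl; sym; trans; cong; cong₂; subst; setoid; ≢-sym)
open import Relation.Nullary using (¬_; yes; no; contradiction)

private variable
  a b i j m n x y : ℕ
  π ρ σ τ ω xs ys : List ℕ

-- Sublists

-- Reduces sortedness to excluding two-entry sublists, so that the forbidden patterns can be used to
-- prove it.
pair⇒AllPairs : ∀ {R : Rel ℕ 0ℓ} → (∀ {x y} → x ∷ y ∷ [] ⊆ xs → R x y) → AllPairs R xs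
pair⇒AllPairs {[]}     R = []
pair⇒AllPairs {x ∷ xs} R =
  All.tabulate (λ y∈ → R (refl ∷ from∈ y∈)) ∷ pair⇒AllPairs (λ s → R (skip x s))

AllPairs⇒pair : ∀ {R : Rel ℕ 0ℓ} → AllPairs R xs → x ∷ y ∷ [] ⊆ xs → R x y
AllPairs⇒pair (px ∷ _)   (refl ∷ s) = All.lookup px (to∈ s)
AllPairs⇒pair (_ ∷ pxs) (skip _ s) = AllPairs⇒pair pxs s

-- The case split behind every proof that appending an entry creates no pattern: an occurrence is an
-- old one or ends at the new entry.
∷ʳ-⊆⁻ : ∀ xs ys → xs ∷ʳ x ⊆ ys ∷ʳ y → xs ∷ʳ x ⊆ ys ⊎ x ≡ y × xs ⊆ ys
∷ʳ-⊆⁻ []           []       (refl ∷ _)    = inj₂ (refl , [])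
∷ʳ-⊆⁻ (_ ∷ [])     []       (refl ∷ ())
∷ʳ-⊆⁻ (_ ∷ _ ∷ _)  []       (refl ∷ ())
∷ʳ-⊆⁻ []           (z ∷ ys) (refl ∷ _)    = inj₁ (refl ∷ minimum ys)
∷ʳ-⊆⁻ (_ ∷ xs)     (z ∷ ys) (refl ∷ s)    with ∷ʳ-⊆⁻ xs ys s
... | inj₁ s′       = inj₁ (refl ∷ s′)
... | inj₂ (eq , s′) = inj₂ (eq , refl ∷ s′)
∷ʳ-⊆⁻ xs           (z ∷ ys) (skip _ s)    with ∷ʳ-⊆⁻ xs ys s
... | inj₁ s′       = inj₁ (skip z s′)
... | inj₂ (eq , s′) = inj₂ (eq , skip z s′)

⊆-++ʳ : ∀ τ → xs ⊆ σ → xs ⊆ σ ++ τ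
⊆-++ʳ = Sublistₚ.++⁺ʳ

adjacent-⊆ : ∀ ρ → a ∷ b ∷ [] ⊆ ρ ++ a ∷ b ∷ τ
adjacent-⊆ ρ = Sublistₚ.++⁺ˡ ρ (refl ∷ refl ∷ minimum _)

-- Containment of patterns in terms of sublists

stepwise⇒mono : (h : ℕ → ℕ) → (∀ v → h v < h (suc v)) → i < j → h i < h j
stepwise⇒mono {j = suc j} h step i<1+j with m<1+n⇒m<n∨m≡n i<1+j
... | inj₁ i<j  = <-trans (stepwise⇒mono h step i<j) (step j)
... | inj₂ refl = step j

embedding : (h : ℕ → ℕ) (p : List ℕ) → map h p ⊆ π →
  Σ (Fin (length p) → Fin (length π)) λ f →
    (∀ i j → i Fin.< j → f i Fin.< f j) × (∀ i → lookup π (f i) ≡ h (lookup p i))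
embedding h []      s = (λ ()) , (λ ()) , (λ ())
embedding h p@(_ ∷ _) (skip _ s) with f , f-mono , f-eq ← embedding h p s =
  suc ∘ f , (λ i j i<j → s≤s (f-mono i j i<j)) , f-eq
embedding {π} h (x ∷ p) (refl ∷ s) with f , f-mono , f-eq ← embedding h p s =
  g , g-mono , g-eq
  where
  g : Fin (length (x ∷ p)) → Fin (length π)
  g zero    = zero
  g (suc i) = suc (f i)
  g-mono : ∀ i j → i Fin.< j → g i Fin.< g j
  g-mono zero    (suc j) _         = s≤s z≤n
  g-mono (suc i) (suc j) (s≤s i<j) = s≤s (f-mono i j i<j)
  g-eq : ∀ i → lookup π (g i) ≡ h (lookup (x ∷ p) i)
  g-eq zero    = refl
  g-eq (suc i) = f-eq i

-- Here `h` sends each value of the pattern to the entry realising it. Pattern values start at 1, so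
-- `h` is only asked to increase from 1 on.
⊆⇒Contains : (h : ℕ → ℕ) → (∀ v → h (suc v) < h (suc (suc v))) →
  ∀ p → All (0 <_) p → map h p ⊆ π → Contains π p
⊆⇒Contains {π} h step p pos s with f , f-mono , f-eq ← embedding h p s =
  f , f-mono , λ i j → mk⇔ (reflects i j) (preserves i j)
  where
  h-mono : 0 < a → a < b → h a < h b
  h-mono {suc a} {suc b} _ (s≤s a<b) = stepwise⇒mono (h ∘ suc) step a<b
  positive : ∀ i → 0 < lookup p i
  positive i = All.lookup pos (∈-lookup i)
  preserves : ∀ i j → lookup p i < lookup p j → lookup π (f i) < lookup π (f j)
  preserves i j rewrite f-eq i | f-eq j = h-mono (positive i)
  reflects : ∀ i j → lookup π (f i) < lookup π (f j) → lookup p i < lookup p j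
  reflects i j lt rewrite f-eq i | f-eq j with <-cmp (lookup p i) (lookup p j)
  ... | tri< p _ _ = p
  ... | tri≈ _ p _ = contradiction lt (<-irrefl (cong h p))
  ... | tri> _ _ p = contradiction lt (<-asym (h-mono (positive j) p))

lookup-drop-⊆ : ∀ π (i : Fin (length π)) →
  xs ⊆ drop (suc (toℕ i)) π → lookup π i ∷ xs ⊆ drop (toℕ i) π
lookup-drop-⊆ (_ ∷ _) zero    s = refl ∷ s
lookup-drop-⊆ (_ ∷ π) (suc i) s = lookup-drop-⊆ π i s

-- Locating the sublist from position `f zero` onwards strengthens the induction: the later entries
-- lie strictly beyond that position, which leaves the entry there free to be chosen.
tabulate-⊆ : ∀ π {m} (f : Fin (suc m) → Fin (length π)) → (∀ i j → i Fin.< j → f i Fin.< f j) →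
  tabulate (lookup π ∘ f) ⊆ drop (toℕ (f zero)) π
tabulate-⊆ π {zero}  f f-mono = lookup-drop-⊆ π (f zero) (minimum _)
tabulate-⊆ π {suc m} f f-mono = lookup-drop-⊆ π (f zero)
  (⊆-trans (tabulate-⊆ π (f ∘ suc) (λ i j i<j → f-mono (suc i) (suc j) (s≤s i<j)))
           (Sublistₚ.drop⁺-≥ (f-mono zero (suc zero) (s≤s z≤n))))

No321 No1423 : List ℕ → Set
No321  π = ∀ {a b c} → c < b → b < a → ¬ (a ∷ b ∷ c ∷ [] ⊆ π)
No1423 π = ∀ {a b c d} → a < b → b < c → c < d → ¬ (a ∷ d ∷ b ∷ c ∷ [] ⊆ π)

Avoids⇒No321 : Avoids π (3 ∷ 2 ∷ 1 ∷ []) → No321 π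
Avoids⇒No321 avoids {a} {b} {c} c<b b<a s =
  avoids (⊆⇒Contains h step (3 ∷ 2 ∷ 1 ∷ []) (s≤s z≤n ∷ s≤s z≤n ∷ s≤s z≤n ∷ []) s)
  where
  h : ℕ → ℕ
  -- A filler below the pattern values; past 3 the values go on upwards from `a` to keep `h`
  -- increasing.
  h 0 = 0
  h 1 = c
  h 2 = b
  h (suc (suc (suc v))) = v ℕ.+ a
  step : ∀ v → h (suc v) < h (suc (suc v))
  step 0 = c<b
  step 1 = b<a
  step (suc (suc v)) = n<1+n _

Avoids⇒No1423 : Avoids π (1 ∷ 4 ∷ 2 ∷ 3 ∷ []) → No1423 π
Avoids⇒No1423 avoids {a} {b} {c} {d} a<b b<c c<d s =
  avoids (⊆⇒Contains h step (1 ∷ 4 ∷ 2 ∷ 3 ∷ []) (s≤s z≤n ∷ s≤s z≤n ∷ s≤s z≤n ∷ s≤s z≤n ∷ []) s)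
  where
  h : ℕ → ℕ
  h 0 = 0
  h 1 = a
  h 2 = b
  h 3 = c
  h (suc (suc (suc (suc v)))) = v ℕ.+ d
  step : ∀ v → h (suc v) < h (suc (suc v))
  step 0 = a<b
  step 1 = b<c
  step 2 = c<d
  step (suc (suc (suc v))) = n<1+n _

Contains⇒⊆ : ∀ {q p} ((f , _) : Contains π (q ∷ p)) → tabulate (lookup π ∘ f) ⊆ π
Contains⇒⊆ {π} (f , f-mono , _) = ⊆-trans (tabulate-⊆ π f f-mono) (Sublistₚ.drop-⊆ (toℕ (f zero)) π)

No321⇒Avoids : No321 π → Avoids π (3 ∷ 2 ∷ 1 ∷ [])
No321⇒Avoids avoid c@(_ , _ , iso) = avoid
  (Equivalence.from (iso (suc (suc zero)) (suc zero)) (s≤s (s≤s z≤n)))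
  (Equivalence.from (iso (suc zero) zero) (s≤s (s≤s (s≤s z≤n))))
  (Contains⇒⊆ c)

No1423⇒Avoids : No1423 π → Avoids π (1 ∷ 4 ∷ 2 ∷ 3 ∷ [])
No1423⇒Avoids avoid c@(_ , _ , iso) = avoid
  (Equivalence.from (iso zero (suc (suc zero))) (s≤s (s≤s z≤n)))
  (Equivalence.from (iso (suc (suc zero)) (suc (suc (suc zero)))) (s≤s (s≤s (s≤s z≤n))))
  (Equivalence.from (iso (suc (suc (suc zero))) (suc zero)) (s≤s (s≤s (s≤s (s≤s z≤n)))))
  (Contains⇒⊆ c)

-- Fishburn lists

Fishburn-prefix : ∀ ω → IsFishburn (σ ++ ω) → IsFishburn σ
Fishburn-prefix ω fish (ρ , a , b , τ , c , refl , c∈τ , eq , a<b) =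
  fish (ρ , a , b , τ ++ ω , c , ++-assoc ρ (a ∷ b ∷ τ) ω , ∈-++⁺ˡ c∈τ , eq , a<b)

-- Only the entry `c` of a violation can be the new one, since `a` and `b` precede it; the second
-- hypothesis treats that case.
Fishburn-∷ʳ : IsFishburn σ → (∀ {a b} → a ∷ b ∷ [] ⊆ σ → a ≡ x ℕ.+ 1 → ¬ a < b) →
  IsFishburn (σ ∷ʳ x)
Fishburn-∷ʳ {σ} fish last (ρ , a , b , τ , c , eq , c∈τ , a≡c+1 , a<b) with List.initLast τ
... | τ′ List.∷ʳ′ z
  with refl , refl ← ∷ʳ-injective σ (ρ ++ a ∷ b ∷ τ′)
         (trans eq (sym (++-assoc ρ (a ∷ b ∷ τ′) [ z ]))) | ∈-++⁻ τ′ c∈τ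
... | inj₁ c∈τ′        = fish (ρ , a , b , τ′ , c , refl , c∈τ′ , a≡c+1 , a<b)
... | inj₂ (here refl) = last (adjacent-⊆ ρ) a≡c+1 a<b

-- A violation starts with an ascent, so none starts at the new head.
Fishburn-∷ : y ≤ x → IsFishburn (y ∷ σ) → IsFishburn (x ∷ y ∷ σ)
Fishburn-∷ y≤x fish ([]    , a , b , τ , c , refl , _ , _ , a<b) = <⇒≱ a<b y≤x
Fishburn-∷ y≤x fish (_ ∷ ρ , a , b , τ , c , eq , rest) = fish (ρ , a , b , τ , c , ∷-injectiveʳ eq , rest)

increasing⇒Fishburn : AllPairs _<_ π → IsFishburn π
increasing⇒Fishburn inc (ρ , a , b , τ , c , refl , c∈τ , refl , _) =
  <-asym (m<m+n c (s≤s z≤n)) (AllPairs⇒pair inc (Sublistₚ.++⁺ˡ ρ (refl ∷ skip b (from∈ c∈τ))))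

-- Permutations

sorted-↭⇒≡ : AllPairs _≤_ xs → AllPairs _≤_ ys → xs ↭ ys → xs ≡ ys
sorted-↭⇒≡ xs↗ ys↗ xs↭ys = ≋⇒≡
  (↗↭↗⇒≋ ≤-totalOrder (AllPairs⇒Sorted ≤-totalOrder xs↗) (AllPairs⇒Sorted ≤-totalOrder ys↗) (↭⇒↭ₛ xs↭ys))

drop-∷ʳ : xs ∷ʳ x ↭ ys ∷ʳ x → xs ↭ ys
drop-∷ʳ {xs} {x} {ys} p = drop-∷ (↭-trans (∷↭∷ʳ x xs) (↭-trans p (↭-sym (∷↭∷ʳ x ys))))

∷ʳ-swap : ∀ xs → (xs ∷ʳ x) ∷ʳ y ↭ (xs ∷ʳ y) ∷ʳ x
∷ʳ-swap {x} {y} xs rewrite ++-assoc xs [ x ] [ y ] | ++-assoc xs [ y ] [ x ] =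
  ++⁺ˡ xs (↭-swap x y ↭-refl)

1‥_ : ℕ → List ℕ
1‥ n = map suc (upTo n)

1‥-∷ʳ : ∀ n → 1‥ (suc n) ≡ 1‥ n ∷ʳ suc n
1‥-∷ʳ n = trans (cong (map suc) (sym (upTo-∷ʳ n))) (map-++ suc (upTo n) [ n ])

∈-1‥⁻ : x ∈ 1‥ n → 1 ≤ x × x ≤ n
∈-1‥⁻ x∈ with _ , i∈ , refl ← ∈-map⁻ suc x∈ = s≤s z≤n , ∈-upTo⁻ i∈

∈-1‥⁺ : 1 ≤ x → x ≤ n → x ∈ 1‥ n
∈-1‥⁺ {suc x} _ x≤n = ∈-map⁺ suc (∈-upTo⁺ x≤n)

1‥-increasing : ∀ n → AllPairs _<_ (1‥ n)
1‥-increasing n = AllPairsₚ.map⁺ (AllPairsₚ.applyUpTo⁺₁ id n (λ i<j _ → s≤s i<j))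

module _ (perm : IsPermutation n π) where
  permutation-bounds : x ∈ π → 1 ≤ x × x ≤ n
  permutation-bounds x∈π = ∈-1‥⁻ (∈-resp-↭ perm x∈π)

  ∈-permutation : 1 ≤ x → x ≤ n → x ∈ π
  ∈-permutation 1≤x x≤n = ∈-resp-↭ (↭-sym perm) (∈-1‥⁺ 1≤x x≤n)

  permutation-Unique : Unique π
  permutation-Unique = Permutationₛ.Unique-resp-↭ (setoid ℕ) (↭⇒↭ₛ (↭-sym perm))
    (AllPairs.map <⇒≢ (1‥-increasing n))

permutation-∷ʳ⁺ : IsPermutation n π → IsPermutation (suc n) (π ∷ʳ suc n)
permutation-∷ʳ⁺ {n} perm rewrite 1‥-∷ʳ n = ++⁺ʳ [ suc n ] perm

permutation-∷ʳ⁻ : IsPermutation (suc n) (π ∷ʳ suc n) → IsPermutation n π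
permutation-∷ʳ⁻ {n} perm rewrite 1‥-∷ʳ n = drop-∷ʳ perm

-- The two ways of appending maxima

No321-prefix : ∀ ω → No321 (σ ++ ω) → No321 σ
No321-prefix ω avoid c<b b<a s = avoid c<b b<a (⊆-++ʳ ω s)

No1423-prefix : ∀ ω → No1423 (σ ++ ω) → No1423 σ
No1423-prefix ω avoid a<b b<c c<d s = avoid a<b b<c c<d (⊆-++ʳ ω s)

-- Membership without the permutation condition, so that it also applies to intermediate lists that
-- skip a value.
record Good (π : List ℕ) : Set where
  field
    fishburn : IsFishburn π
    no321    : No321 π
    no1423   : No1423 π

open Good

InF⇒Good : InF n π → Good π
InF⇒Good (_ , fish , a321 , a1423) = record
  { fishburn = fish ; no321 = Avoids⇒No321 a321 ; no1423 = Avoids⇒No1423 a1423 }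

Good⇒InF : IsPermutation n π → Good π → InF n π
Good⇒InF perm g = perm , fishburn g , No321⇒Avoids (no321 g) , No1423⇒Avoids (no1423 g)

Good-prefix : ∀ ω → Good (σ ++ ω) → Good σ
Good-prefix ω g = record
  { fishburn = Fishburn-prefix ω (fishburn g)
  ; no321    = No321-prefix ω (no321 g)
  ; no1423   = No1423-prefix ω (no1423 g) }

increasing⇒Good : AllPairs _<_ π → Good π
increasing⇒Good inc = record
  { fishburn = increasing⇒Fishburn inc
  ; no321    = λ c<b b<a s → <-asym b<a (AllPairs⇒pair inc (⊆-trans (refl ∷ refl ∷ skip _ []) s))
  ; no1423   = λ a<b b<c c<d s →
      <-asym (<-trans b<c c<d) (AllPairs⇒pair inc (⊆-trans (skip _ (refl ∷ refl ∷ skip _ [])) s)) }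

∈-⊆ : y ∈ xs → xs ⊆ ys → y ∈ ys
∈-⊆ y∈ s = Sublist.lookup s y∈

-- In each forbidden configuration the last entry is smaller than an earlier one.
Good-∷ʳ-max : (∀ {y} → y ∈ σ → y ≤ x) → Good σ → Good (σ ∷ʳ x)
Good-∷ʳ-max {σ} {x} bound g = record
  { fishburn = Fishburn-∷ʳ (fishburn g) λ s a≡x+1 _ →
      1+n≰n (subst (_≤ x) (trans a≡x+1 (+-comm x 1)) (bound (∈-⊆ (here refl) s)))
  ; no321 = λ { {a} {b} c<b b<a s → [ no321 g c<b b<a
              , (λ { (refl , s′) → <⇒≱ c<b (bound (∈-⊆ (there (here refl)) s′)) }) ]′
              (∷ʳ-⊆⁻ (a ∷ b ∷ []) σ s) }
  ; no1423 = λ { {a} {b} {c} {d} a<b b<c c<d s → [ no1423 g a<b b<c c<d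
              , (λ { (refl , s′) → <⇒≱ c<d (bound (∈-⊆ (there (here refl)) s′)) }) ]′
              (∷ʳ-⊆⁻ (a ∷ d ∷ b ∷ []) σ s) } }

-- Append x+1 as a maximum first. An occurrence ending at x would then need, for the Fishburn
-- condition, an entry above x+1; for 321, two distinct entries above x; for 1423, an entry above x
-- with a smaller b < x after it, though only the final x+1 exceeds x.
Good-swap : (∀ {y} → y ∈ σ → y ≤ x) → Good σ → Good ((σ ∷ʳ suc x) ∷ʳ x)
Good-swap {σ} {x} bound g = record
  { fishburn = Fishburn-∷ʳ (fishburn g′) λ {a} {b} s a≡x+1 a<b →
      <⇒≱ a<b (subst (b ≤_) (trans (+-comm 1 x) (sym a≡x+1)) (bound′ (∈-⊆ (there (here refl)) s)))
  ; no321 = λ { {a} {b} c<b b<a s → [ no321 g′ c<b b<a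
              , (λ { (refl , s′) → <⇒≱ (≤-<-trans c<b b<a) (bound′ (∈-⊆ (here refl) s′)) }) ]′
              (∷ʳ-⊆⁻ (a ∷ b ∷ []) (σ ∷ʳ suc x) s) }
  ; no1423 = λ { {a} {b} {c} {d} a<b b<c c<d s → [ no1423 g′ a<b b<c c<d
              , (λ { (refl , s′) → [ (λ s″ → <⇒≱ c<d (bound (∈-⊆ (there (here refl)) s″)))
                                   , (λ { (refl , _) → <-asym b<c (n<1+n _) }) ]′
                                   (∷ʳ-⊆⁻ (a ∷ d ∷ []) σ s′) }) ]′
              (∷ʳ-⊆⁻ (a ∷ d ∷ b ∷ []) (σ ∷ʳ suc x) s) } }
  where
  bound′ : y ∈ σ ∷ʳ suc x → y ≤ suc x
  bound′ y∈ with ∈-++⁻ σ y∈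
  ... | inj₁ y∈σ         = m≤n⇒m≤1+n (bound y∈σ)
  ... | inj₂ (here refl) = ≤-refl
  g′ : Good (σ ∷ʳ suc x)
  g′ = Good-∷ʳ-max (m≤n⇒m≤1+n ∘ bound) g

InF-∷ʳ⁺ : InF n σ → InF (suc n) (σ ∷ʳ suc n)
InF-∷ʳ⁺ F@(perm , _) = Good⇒InF (permutation-∷ʳ⁺ perm)
  (Good-∷ʳ-max (m≤n⇒m≤1+n ∘ proj₂ ∘ permutation-bounds perm) (InF⇒Good F))

InF-∷ʳ⁻ : InF (suc n) (σ ∷ʳ suc n) → InF n σ
InF-∷ʳ⁻ {n} F@(perm , _) = Good⇒InF (permutation-∷ʳ⁻ perm) (Good-prefix [ suc n ] (InF⇒Good F))

InF-swap⁺ : InF n σ → InF (2 ℕ.+ n) (σ ++ 2 ℕ.+ n ∷ suc n ∷ [])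
InF-swap⁺ {n} {σ} F@(perm , _) rewrite sym (++-assoc σ [ 2 ℕ.+ n ] [ suc n ]) = Good⇒InF
  (↭-trans (∷ʳ-swap σ) (permutation-∷ʳ⁺ (permutation-∷ʳ⁺ perm)))
  (Good-swap (m≤n⇒m≤1+n ∘ proj₂ ∘ permutation-bounds perm) (InF⇒Good F))

InF-swap⁻ : InF (2 ℕ.+ n) (σ ++ 2 ℕ.+ n ∷ suc n ∷ []) → InF n σ
InF-swap⁻ {n} {σ} F@(perm , _) = Good⇒InF
  (permutation-∷ʳ⁻ (permutation-∷ʳ⁻ (↭-trans (∷ʳ-swap σ)
    (subst (IsPermutation (2 ℕ.+ n)) (sym (++-assoc σ [ 2 ℕ.+ n ] [ suc n ])) perm))))
  (Good-prefix (2 ℕ.+ n ∷ suc n ∷ []) (InF⇒Good F))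

-- The exceptional permutations

-- The values j+1 and j+2 are left out; `block` puts them at the two ends.
gap : ℕ → ℕ → List ℕ
gap j r = 1‥ j ++ applyUpTo (λ i → 3 ℕ.+ j ℕ.+ i) r

-- j+2, 1, …, j, j+3, …, j+r+2, j+1
block : ℕ → ℕ → List ℕ
block j r = (2 ℕ.+ j ∷ gap j r) ∷ʳ suc j

gap-∷ʳ : ∀ j r → gap j (suc r) ≡ gap j r ∷ʳ (3 ℕ.+ j ℕ.+ r)
gap-∷ʳ j r = trans (cong (1‥ j ++_) (sym (applyUpTo-∷ʳ (λ i → 3 ℕ.+ j ℕ.+ i) r)))
  (sym (++-assoc (1‥ j) _ _))

∈-gap⁻ : ∀ j r → x ∈ gap j r → x ≤ j ⊎ 3 ℕ.+ j ≤ x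
∈-gap⁻ j r x∈ with ∈-++⁻ (1‥ j) x∈
... | inj₁ x∈1‥j = inj₁ (proj₂ (∈-1‥⁻ x∈1‥j))
... | inj₂ x∈up with _ , _ , refl ← ∈-applyUpTo⁻ (λ i → 3 ℕ.+ j ℕ.+ i) x∈up = inj₂ (m≤m+n _ _)

gap-increasing : ∀ j r → AllPairs _<_ (gap j r)
gap-increasing j zero    rewrite ++-identityʳ (1‥ j) = 1‥-increasing j
gap-increasing j (suc r) = AllPairsₚ.++⁺ (1‥-increasing j)
  (AllPairsₚ.applyUpTo⁺₁ (λ i → 3 ℕ.+ j ℕ.+ i) (suc r) (λ i<k _ → +-monoʳ-< (3 ℕ.+ j) i<k))
  (All.tabulate λ x∈ → Allₚ.applyUpTo⁺₂ (λ i → 3 ℕ.+ j ℕ.+ i) (suc r) λ i →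
    ≤-<-trans (proj₂ (∈-1‥⁻ x∈)) (m<n⇒m<1+n (m<n⇒m<1+n (s≤s (m≤m+n j i)))))

-- For r = 0, moving the head to the end gives the identity. For larger r, the maximum stands just
-- before the last entry, and swapping the two makes it an appended maximum.
block-permutation : ∀ j r → IsPermutation (2 ℕ.+ (j ℕ.+ r)) (block j r)
block-permutation j zero rewrite ++-identityʳ (1‥ j) | +-identityʳ j =
  ↭-trans (∷↭∷ʳ (2 ℕ.+ j) (1‥ j ∷ʳ suc j))
    (↭-reflexive (sym (trans (1‥-∷ʳ (suc j)) (cong (_∷ʳ (2 ℕ.+ j)) (1‥-∷ʳ j)))))
block-permutation j (suc r) rewrite gap-∷ʳ j r | +-suc j r =
  ↭-trans (∷ʳ-swap (2 ℕ.+ j ∷ gap j r)) (permutation-∷ʳ⁺ (block-permutation j r))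

-- Everything between the two ends increases. The parameter `suc i` makes the second entry 1, so the
-- list starts with a descent; without it the head could begin a Fishburn violation ending at the
-- last entry.
block-Good : ∀ i r → Good (block (suc i) r)
block-Good i r = record
  { fishburn = Fishburn-∷ (s≤s z≤n)
      (Fishburn-∷ʳ (increasing⇒Fishburn inc) λ { s refl _ →
        3+i∉gap (subst (_∈ gap (suc i) r) (+-comm (2 ℕ.+ i) 1) (∈-⊆ (here refl) s)) })
  ; no321 = λ { {a} {b} c<b b<a s → [ (λ s′ → <-asym c<b (AllPairs⇒pair inc (tail s′)))
              -- With the head as `a` and the last entry as `c`, there is no integer strictly
              -- between them for `b`.
              , (λ { (refl , refl ∷ _) → 1+n≰n (<-≤-trans b<a c<b)
                   ; (refl , skip _ s′) → <-asym b<a (AllPairs⇒pair inc s′) }) ]′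
              (∷ʳ-⊆⁻ (a ∷ b ∷ []) (3 ℕ.+ i ∷ gap (suc i) r) s) }
  ; no1423 = λ { {a} {b} {c} {d} a<b b<c c<d s → [
                (λ s′ → <-asym (<-trans b<c c<d) (AllPairs⇒pair inc (⊆-trans (refl ∷ refl ∷ skip _ []) (tail s′))))
              , (λ { (refl , s′) → <-asym (<-trans b<c c<d) (AllPairs⇒pair inc (tail s′)) }) ]′
              (∷ʳ-⊆⁻ (a ∷ d ∷ b ∷ []) (3 ℕ.+ i ∷ gap (suc i) r) s) } }
  where
  inc : AllPairs _<_ (gap (suc i) r)
  inc = gap-increasing (suc i) r
  3+i∉gap : 3 ℕ.+ i ∉ gap (suc i) r
  3+i∉gap 3+i∈ with ∈-gap⁻ (suc i) r 3+i∈
  ... | inj₁ le = 1+n≰n (≤-trans (n≤1+n _) le)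
  ... | inj₂ le = 1+n≰n le
  tail : a ∷ xs ⊆ x ∷ ys → xs ⊆ ys
  tail = Sublistₚ.∷⁻

InF-block : ∀ i r → InF (3 ℕ.+ (i ℕ.+ r)) (block (suc i) r)
InF-block i r = Good⇒InF (block-permutation (suc i) r) (block-Good i r)

-- Classification by the last entry

-- Describes lists of length m+2, so that both shorter lengths of the recursion appear without
-- subtraction.
data Shape (m : ℕ) : List ℕ → Set where
  max-last  : InF (suc m) σ → Shape m (σ ∷ʳ (2 ℕ.+ m))
  swap-last : InF m σ → Shape m (σ ++ 2 ℕ.+ m ∷ suc m ∷ [])
  is-block  : ∀ i r → suc (i ℕ.+ r) ≡ m → Shape m (block (suc i) r)

-- The case in which an entry `b` follows k+1 before the final k is reached.
module _ {ρ τ : List ℕ} {k b n : ℕ} (F : InF n (ρ ++ suc k ∷ b ∷ τ ∷ʳ k)) where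
  private
    perm   = proj₁ F
    good   = InF⇒Good F

    rest : List ℕ
    rest = b ∷ τ ∷ʳ k

    distinct : x ∷ y ∷ [] ⊆ ρ ++ suc k ∷ rest → x ≢ y
    distinct = AllPairs⇒pair (permutation-Unique perm)

    after-ρ : xs ⊆ suc k ∷ rest → xs ⊆ ρ ++ suc k ∷ rest
    after-ρ = Sublistₚ.++⁺ˡ ρ

    through-ρ : x ∈ ρ → xs ⊆ suc k ∷ rest → x ∷ xs ⊆ ρ ++ suc k ∷ rest
    through-ρ x∈ρ = Sublistₚ.++⁺ (from∈ x∈ρ)

    k∈ : k ∈ τ ∷ʳ k
    k∈ = ∈-++⁺ʳ τ (here refl)

    b<k : b < k
    b<k with <-cmp b k
    ... | tri< b<k _ _ = b<k
    ... | tri≈ _ b≡k _ = contradiction b≡k (distinct (after-ρ (skip _ (refl ∷ from∈ k∈))))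
    ... | tri> _ _ k<b = ⊥-elim (fishburn good
      (ρ , suc k , b , τ ∷ʳ k , k , refl , k∈ , +-comm 1 k
      , ≤∧≢⇒< k<b (distinct (after-ρ (refl ∷ refl ∷ minimum _)))))

    -- An x above k would form 321 with k+1, b; an x below b would form 1423 with k+1, b, k.
    ρ-bounds : x ∈ ρ → b < x × x < k
    ρ-bounds {x} x∈ρ = b<x , x<k
      where
      x<k : x < k
      x<k with <-cmp x k
      ... | tri< x<k _ _ = x<k
      ... | tri≈ _ x≡k _ = contradiction x≡k (distinct (through-ρ x∈ρ (from∈ (there (there k∈)))))
      ... | tri> _ _ k<x = ⊥-elim (no321 good (m<n⇒m<1+n b<k)
        (≤∧≢⇒< k<x (≢-sym (distinct (through-ρ x∈ρ (refl ∷ minimum _)))))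
        (through-ρ x∈ρ (refl ∷ refl ∷ minimum _)))
      b<x : b < x
      b<x with <-cmp b x
      ... | tri< b<x _ _ = b<x
      ... | tri≈ _ b≡x _ = contradiction (sym b≡x) (distinct (through-ρ x∈ρ (skip _ (refl ∷ minimum _))))
      ... | tri> _ _ x<b = ⊥-elim (no1423 good x<b b<k (n<1+n k)
        (through-ρ x∈ρ (refl ∷ refl ∷ from∈ k∈)))

    -- If ρ has entries, its least entry x is followed by a larger entry and, later, by x − 1.
    ρ-empty : ∀ x → x ∉ ρ
    ρ-empty = <-rec (_∉ ρ) step
      where
      step : ∀ x → (∀ {y} → y < x → y ∉ ρ) → x ∉ ρ
      step zero    rec x∈ρ = contradiction (proj₁ (ρ-bounds x∈ρ)) (λ ())
      step (suc y) rec x∈ρ with ∈-∃++ x∈ρ | y-later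
        where
        y<k : y < k
        y<k = <-trans (n<1+n y) (proj₂ (ρ-bounds x∈ρ))
        1≤b : 1 ≤ b
        1≤b = proj₁ (permutation-bounds perm (∈-++⁺ʳ ρ (there (here refl))))
        y∈ : y ∈ ρ ++ suc k ∷ rest
        y∈ = ∈-permutation perm (≤-trans 1≤b (ℕ.s≤s⁻¹ (proj₁ (ρ-bounds x∈ρ))))
          (≤-trans (n≤1+n y) (proj₂ (permutation-bounds perm (∈-++⁺ˡ x∈ρ))))
        -- Minimality of x keeps y = x - 1 out of `ρ`, and y < k makes it differ from k+1.
        y-later : y ∈ rest
        y-later with ∈-++⁻ ρ y∈
        ... | inj₁ y∈ρ          = contradiction y∈ρ (rec (n<1+n y))
        ... | inj₂ (here refl)  = contradiction y<k (<⇒≯ (n<1+n k))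
        ... | inj₂ (there y∈)   = y∈
      ... | ρ₁ , [] , ρ≡ | y∈rest = fishburn good
        ( ρ₁ , suc y , suc k , rest , y
        , trans (cong (_++ suc k ∷ rest) ρ≡) (++-assoc ρ₁ [ suc y ] _)
        , y∈rest , +-comm 1 y , m<n⇒m<1+n (proj₂ (ρ-bounds x∈ρ)))
      ... | ρ₁ , z ∷ ρ₂ , ρ≡ | y∈rest = fishburn good
        ( ρ₁ , suc y , z , ρ₂ ++ suc k ∷ rest , y
        , trans (cong (_++ suc k ∷ rest) ρ≡) (++-assoc ρ₁ (suc y ∷ z ∷ ρ₂) _)
        , ∈-++⁺ʳ ρ₂ (there y∈rest) , +-comm 1 y
        , ≤∧≢⇒< (≮⇒≥ λ z<x → rec z<x z∈ρ)
            (distinct (⊆-++ʳ _ (subst (suc y ∷ z ∷ [] ⊆_) (sym ρ≡) (adjacent-⊆ ρ₁)))))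
        where
        z∈ρ : z ∈ ρ
        z∈ρ = subst (z ∈_) (sym ρ≡) (∈-++⁺ʳ ρ₁ (there (here refl)))

    after-head : xs ⊆ b ∷ τ → xs ⊆ ρ ++ suc k ∷ rest
    after-head s = after-ρ (skip _ (⊆-++ʳ [ k ] s))

    before-last : xs ⊆ b ∷ τ → xs ∷ʳ k ⊆ ρ ++ suc k ∷ rest
    before-last s = after-ρ (skip _ (Sublistₚ.++⁺ s ⊆-refl))

    -- Suppose x > y. If x < k, then k+1, x, y is a 321; if y > k, then x, y, k is one. Otherwise y
    -- < k < x, so x is not b, and either b, x, y, k is a 1423 or k+1, b, y is a 321.
    middle-sorted : x ∷ y ∷ [] ⊆ b ∷ τ → x ≤ y
    middle-sorted {x} {y} s with x ≤? y
    ... | yes x≤y = x≤y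
    ... | no x≰y with <-cmp x k | <-cmp y k
    ...   | tri< x<k _ _ | _ = ⊥-elim
      (no321 good (≰⇒> x≰y) (m<n⇒m<1+n x<k) (after-ρ (refl ∷ ⊆-++ʳ [ k ] s)))
    ...   | tri≈ _ x≡k _ | _ = contradiction x≡k
      (distinct (before-last (⊆-trans (refl ∷ skip _ []) s)))
    ...   | tri> _ _ k<x | tri> _ _ k<y = ⊥-elim (no321 good k<y (≰⇒> x≰y) (before-last s))
    ...   | tri> _ _ k<x | tri≈ _ y≡k _ = contradiction y≡k
      (distinct (before-last (⊆-trans (skip _ (refl ∷ [])) s)))
    middle-sorted {x} {y} (refl ∷ _) | no _ | tri> _ _ k<x | tri< y<k _ _ = contradiction b<k (<⇒≯ k<x)
    middle-sorted {x} {y} (skip _ s) | no _ | tri> _ _ k<x | tri< y<k _ _ with <-cmp b y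
    ... | tri< b<y _ _ = ⊥-elim (no1423 good b<y y<k k<x (before-last (refl ∷ s)))
    ... | tri≈ _ b≡y _ = contradiction b≡y (distinct (after-head (refl ∷ ⊆-trans (skip _ (refl ∷ [])) s)))
    ... | tri> _ _ y<b = ⊥-elim (no321 good y<b (m<n⇒m<1+n b<k)
      (after-ρ (refl ∷ refl ∷ ⊆-++ʳ [ k ] (⊆-trans (skip _ (refl ∷ [])) s))))

  block-shape : ∃[ i ] ∃[ r ] n ≡ 3 ℕ.+ (i ℕ.+ r) × ρ ++ suc k ∷ b ∷ τ ∷ʳ k ≡ block (suc i) r
  block-shape = go k ρ refl refl perm
    where
    -- `k` and `ρ` are module parameters; copies tied to them by equations can be matched on.
    go : ∀ k′ ρ′ → k′ ≡ k → ρ′ ≡ ρ → IsPermutation n (ρ′ ++ suc k′ ∷ b ∷ τ ∷ʳ k′) →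
      ∃[ i ] ∃[ r ] n ≡ 3 ℕ.+ (i ℕ.+ r) × ρ′ ++ suc k′ ∷ b ∷ τ ∷ʳ k′ ≡ block (suc i) r
    go k′ (x ∷ _) _ refl _ = contradiction (here refl) (ρ-empty x)
    go zero [] refl _ _ = contradiction b<k (λ ())
    -- For k = 1 the entry b would be 0.
    go (suc zero) [] refl _ perm′ =
      contradiction (proj₁ (permutation-bounds perm′ (there (here refl)))) (<⇒≱ b<k)
    go (suc (suc i)) [] refl _ perm′
      with r , refl ← m≤n⇒∃[o]m+o≡n (proj₂ (permutation-bounds perm′ (here refl))) =
      i , r , refl , cong (λ mid → (3 ℕ.+ i ∷ mid) ∷ʳ (2 ℕ.+ i)) (sorted-↭⇒≡
        (pair⇒AllPairs middle-sorted)
        (AllPairs.map <⇒≤ (gap-increasing (suc i) r))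
        (drop-∷ʳ (drop-∷ (↭-trans perm′ (↭-sym (block-permutation (suc i) r))))))

shape : InF (2 ℕ.+ m) π → Shape m π
shape {m} {π} F@(perm , _) with List.initLast π
... | [] = contradiction (∈-permutation perm (s≤s z≤n) (s≤s z≤n)) λ ()
... | σ List.∷ʳ′ k with k ≟ 2 ℕ.+ m
...   | yes refl = max-last (InF-∷ʳ⁻ F)
...   | no k≢n with ∈-++⁻ σ (∈-permutation perm (s≤s z≤n)
                  (≤∧≢⇒< (proj₂ (permutation-bounds perm (∈-++⁺ʳ σ (here refl)))) k≢n))
...     | inj₂ (here ())
...     | inj₁ k+1∈σ with ∈-∃++ k+1∈σ
...       | ρ , b ∷ τ , refl = subst (Shape m) (sym (++-assoc ρ (suc k ∷ b ∷ τ) [ k ])) blocks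
  where
  blocks : Shape m (ρ ++ suc k ∷ b ∷ τ ∷ʳ k)
  blocks with i , r , eq , π≡ ← block-shape {ρ} {τ}
                (subst (InF (2 ℕ.+ m)) (++-assoc ρ (suc k ∷ b ∷ τ) [ k ]) F)
    = subst (Shape m) (sym π≡) (is-block i r (suc-injective (suc-injective (sym eq))))
...       | ρ , [] , refl with k ≟ suc m
...         | yes refl = subst (Shape m) (sym (++-assoc ρ [ suc k ] [ k ]))
  (swap-last (InF-swap⁻ (subst (InF (2 ℕ.+ m)) (++-assoc ρ [ suc k ] [ k ]) F)))
-- Here k+1 is directly followed by k and is not the maximum n, so n stands before it and n, k+1, k
-- is a 321.
...         | no k≢ = contradiction (∈-permutation perm (s≤s z≤n) ≤-refl) n∉
  where
  k+1<n : suc k < 2 ℕ.+ m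
  k+1<n = ≤∧≢⇒< (proj₂ (permutation-bounds perm (∈-++⁺ˡ k+1∈σ))) (k≢ ∘ suc-injective)
  n∉ : 2 ℕ.+ m ∉ (ρ ∷ʳ suc k) ∷ʳ k
  n∉ n∈ with ∈-++⁻ (ρ ∷ʳ suc k) n∈
  ... | inj₂ (here refl) = k≢n refl
  ... | inj₁ n∈′ with ∈-++⁻ ρ n∈′
  ...   | inj₂ (here refl) = k≢ refl
  ...   | inj₁ n∈ρ = no321 (InF⇒Good F) (n<1+n k) k+1<n
    (Sublistₚ.++⁺ (Sublistₚ.++⁺ (from∈ n∈ρ) (⊆-refl {x = [ suc k ]})) ⊆-refl)

-- The enumeration

-- For i < m the subtraction is exact, and each list has length m+2.
blocks : ℕ → List (List ℕ)
blocks m = map (λ i → block (suc i) (m ∸ suc i)) (upTo m)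

swaps : ℕ → List (List ℕ) → List (List ℕ)
swaps m = map (_++ 2 ℕ.+ m ∷ suc m ∷ [])

-- The identity is kept apart: appending a maximum to it gives the identity again, while every list
-- here has a descent.
withDescent : ℕ → List (List ℕ)
withDescent zero          = []
withDescent (suc zero)    = []
withDescent (suc (suc m)) =
  map (_∷ʳ (2 ℕ.+ m)) (withDescent (suc m)) ++ swaps m (1‥ m ∷ withDescent m) ++ blocks m

enumeration : ℕ → List (List ℕ)
enumeration n = 1‥ n ∷ withDescent n

InF-1‥ : ∀ n → InF n (1‥ n)
InF-1‥ n = Good⇒InF ↭-refl (increasing⇒Good (1‥-increasing n))

-- The analogue of `Shape` with shorter lists taken from the enumeration; inductions over
-- `withDescent` match on it.
data DescentShape (m : ℕ) : List ℕ → Set where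
  max-last  : σ ∈ withDescent (suc m) → DescentShape m (σ ∷ʳ (2 ℕ.+ m))
  swap-last : σ ∈ enumeration m → DescentShape m (σ ++ 2 ℕ.+ m ∷ suc m ∷ [])
  is-block  : ∀ i r → suc (i ℕ.+ r) ≡ m → DescentShape m (block (suc i) r)

∈-blocks⁻ : π ∈ blocks m → ∃[ i ] ∃[ r ] suc (i ℕ.+ r) ≡ m × π ≡ block (suc i) r
∈-blocks⁻ {m = m} π∈ with i , i∈ , refl ← ∈-map⁻ (λ i → block (suc i) (m ∸ suc i)) π∈ =
  i , m ∸ suc i , m+[n∸m]≡n (∈-upTo⁻ i∈) , refl

∈-blocks⁺ : ∀ i r → block (suc i) r ∈ blocks (suc (i ℕ.+ r))
∈-blocks⁺ i r = subst (λ t → block (suc i) t ∈ blocks (suc (i ℕ.+ r))) (m+n∸m≡n i r)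
  (∈-map⁺ (λ j → block (suc j) (suc (i ℕ.+ r) ∸ suc j)) (∈-upTo⁺ (s≤s (m≤m+n i r))))

∈-withDescent⁻ : ∀ m → π ∈ withDescent (2 ℕ.+ m) → DescentShape m π
∈-withDescent⁻ m π∈ with ∈-++⁻ (map (_∷ʳ (2 ℕ.+ m)) (withDescent (suc m))) π∈
... | inj₁ π∈max with _ , σ∈ , refl ← ∈-map⁻ (_∷ʳ (2 ℕ.+ m)) π∈max = max-last σ∈
... | inj₂ π∈′ with ∈-++⁻ (swaps m (enumeration m)) π∈′
...   | inj₁ π∈swaps with _ , σ∈ , refl ← ∈-map⁻ (_++ 2 ℕ.+ m ∷ suc m ∷ []) π∈swaps = swap-last σ∈
...   | inj₂ π∈blocks with i , r , eq , refl ← ∈-blocks⁻ π∈blocks = is-block i r eq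

∈-withDescent⁺ : DescentShape m π → π ∈ withDescent (2 ℕ.+ m)
∈-withDescent⁺ {m} (max-last σ∈) = ∈-++⁺ˡ (∈-map⁺ (_∷ʳ (2 ℕ.+ m)) σ∈)
∈-withDescent⁺ {m} (swap-last σ∈) = ∈-++⁺ʳ (map (_∷ʳ (2 ℕ.+ m)) (withDescent (suc m)))
  (∈-++⁺ˡ (∈-map⁺ (_++ 2 ℕ.+ m ∷ suc m ∷ []) σ∈))
∈-withDescent⁺ {m} (is-block i r refl) = ∈-++⁺ʳ (map (_∷ʳ (2 ℕ.+ m)) (withDescent (suc m)))
  (∈-++⁺ʳ (swaps m (enumeration m)) (∈-blocks⁺ i r))

DescentShape⇒InF : (∀ {σ} → σ ∈ withDescent (suc m) → InF (suc m) σ) →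
  (∀ {σ} → σ ∈ enumeration m → InF m σ) → DescentShape m π → InF (2 ℕ.+ m) π
DescentShape⇒InF ih₁ ih₀ (max-last σ∈)       = InF-∷ʳ⁺ (ih₁ σ∈)
DescentShape⇒InF ih₁ ih₀ (swap-last σ∈)      = InF-swap⁺ (ih₀ σ∈)
DescentShape⇒InF ih₁ ih₀ (is-block i r refl) = InF-block i r

mutual
  enumeration⇒InF : ∀ n → π ∈ enumeration n → InF n π
  enumeration⇒InF n (here refl) = InF-1‥ n
  enumeration⇒InF n (there π∈)  = withDescent⇒InF n π∈

  withDescent⇒InF : ∀ n → π ∈ withDescent n → InF n π
  withDescent⇒InF (suc (suc m)) π∈ =
    DescentShape⇒InF (withDescent⇒InF (suc m)) (enumeration⇒InF m) (∈-withDescent⁻ m π∈)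

Shape⇒enumeration : (∀ {σ} → InF (suc m) σ → σ ∈ enumeration (suc m)) →
  (∀ {σ} → InF m σ → σ ∈ enumeration m) → Shape m π → π ∈ enumeration (2 ℕ.+ m)
Shape⇒enumeration ih₁ ih₀ (swap-last G)     = there (∈-withDescent⁺ (swap-last (ih₀ G)))
Shape⇒enumeration ih₁ ih₀ (is-block i r eq) = there (∈-withDescent⁺ (is-block i r eq))
Shape⇒enumeration {m} ih₁ ih₀ (max-last G) with ih₁ G
... | here refl = here (sym (1‥-∷ʳ (suc m)))
... | there σ∈  = there (∈-withDescent⁺ (max-last σ∈))

InF⇒enumeration : ∀ n → InF n π → π ∈ enumeration n
InF⇒enumeration zero          (perm , _) = here (↭-empty-inv perm)
InF⇒enumeration (suc zero)    (perm , _) = here (↭-singleton-inv perm)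
InF⇒enumeration (suc (suc m)) F =
  Shape⇒enumeration (InF⇒enumeration (suc m)) (InF⇒enumeration m) (shape F)

-- Descents

1‥-no-descent : ∀ n → ¬ HasDescent (1‥ n)
1‥-no-descent n (ρ , a , b , τ , eq , b<a) = <-asym b<a
  (AllPairs⇒pair (1‥-increasing n) (subst (a ∷ b ∷ [] ⊆_) (sym eq) (adjacent-⊆ ρ)))

HasDescent-++ : ∀ ω → HasDescent σ → HasDescent (σ ++ ω)
HasDescent-++ ω (ρ , a , b , τ , refl , b<a) =
  ρ , a , b , τ ++ ω , ++-assoc ρ (a ∷ b ∷ τ) ω , b<a

DescentShape⇒HasDescent : (∀ {σ} → σ ∈ withDescent (suc m) → HasDescent σ) →
  DescentShape m π → HasDescent π
DescentShape⇒HasDescent ih (max-last σ∈)     = HasDescent-++ _ (ih σ∈)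
DescentShape⇒HasDescent ih (swap-last {σ} _) = σ , _ , _ , [] , refl , n<1+n _
DescentShape⇒HasDescent ih (is-block i r _)  = [] , _ , _ , _ , refl , s≤s (s≤s z≤n)

withDescent⇒HasDescent : ∀ n → π ∈ withDescent n → HasDescent π
withDescent⇒HasDescent (suc (suc m)) π∈ =
  DescentShape⇒HasDescent (withDescent⇒HasDescent (suc m)) (∈-withDescent⁻ m π∈)

-- The last two entries

-- For r = 0 the next-to-last entry is not the maximum, which excludes such blocks from labels (1)
-- and (2b).
block-zero-end : ∀ i → block (suc i) 0 ≡ σ ++ x ∷ y ∷ [] → x ≡ suc i × y ≡ 2 ℕ.+ i
block-zero-end {σ} {x} {y} i eq
  with eq′ , refl ← ∷ʳ-injective (3 ℕ.+ i ∷ gap (suc i) 0) (σ ∷ʳ x)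
                      (trans eq (sym (++-assoc σ [ x ] [ y ]))) =
  sym (∷ʳ-injectiveʳ (3 ℕ.+ i ∷ 1‥ i) σ (trans (cong (3 ℕ.+ i ∷_) (sym gap≡)) eq′)) , refl
  where
  gap≡ : gap (suc i) 0 ≡ 1‥ i ∷ʳ suc i
  gap≡ = trans (++-identityʳ _) (1‥-∷ʳ i)

block-suc-end : ∀ j r → block j (suc r) ≡ (2 ℕ.+ j ∷ gap j r) ++ 3 ℕ.+ j ℕ.+ r ∷ suc j ∷ []
block-suc-end j r = trans (cong (λ g → (2 ℕ.+ j ∷ g) ∷ʳ suc j) (gap-∷ʳ j r))
  (++-assoc (2 ℕ.+ j ∷ gap j r) _ _)

block-last : ∀ j r → block j r ≡ σ ∷ʳ x → x ≡ suc j
block-last {σ} j r eq = sym (∷ʳ-injectiveʳ (2 ℕ.+ j ∷ gap j r) σ eq)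

swap-last≡ : ∀ σ → σ ++ x ∷ y ∷ [] ≡ τ ∷ʳ b → y ≡ b
swap-last≡ {x} {y} σ eq = ∷ʳ-injectiveʳ (σ ∷ʳ x) _ (trans (++-assoc σ [ x ] [ y ]) eq)

-- For r = 0 the next-to-last entries differ; for r > 0 the last entry i+2 is below m+1.
block≢swap : suc (i ℕ.+ j) ≡ m → block (suc i) j ≢ σ ++ 2 ℕ.+ m ∷ suc m ∷ []
block≢swap {i} {zero} refl eq =
  contradiction (proj₁ (block-zero-end i eq)) (>⇒≢ (s≤s (s≤s (m≤n⇒m≤1+n (m≤m+n i 0)))))
block≢swap {i} {suc r} {σ = σ} refl eq =
  contradiction (sym (block-last (suc i) (suc r) (trans eq (sym (++-assoc σ [ _ ] [ _ ])))))
    (<⇒≢ (s≤s (s≤s (m<m+n i (s≤s z≤n)))))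

-- Distinctness of the enumerated permutations

blocks-Unique : ∀ m → Unique (blocks m)
blocks-Unique m = Uniqueₚ.map⁺
  (λ {i} {j} eq → suc-injective (suc-injective (sym (block-last
    {2 ℕ.+ suc j ∷ gap (suc j) (m ∸ suc j)} (suc i) (m ∸ suc i) eq))))
  (Uniqueₚ.upTo⁺ m)

∷ʳ-Unique : ∀ {πs : List (List ℕ)} x → Unique πs → Unique (map (_∷ʳ x) πs)
∷ʳ-Unique x = Uniqueₚ.map⁺ (λ {σ} {τ} → ∷ʳ-injectiveˡ σ τ)

swaps-Unique : ∀ {πs} m → Unique πs → Unique (swaps m πs)
swaps-Unique m = Uniqueₚ.map⁺ (λ {σ} {τ} → ++-cancelʳ _ σ τ)

mutual
  -- Of the three families only the first ends with the maximum; `block≢swap` separates the other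
  -- two.
  withDescent-Unique : ∀ n → Unique (withDescent n)
  withDescent-Unique zero          = []
  withDescent-Unique (suc zero)    = []
  withDescent-Unique (suc (suc m)) = Uniqueₚ.++⁺
    (∷ʳ-Unique (2 ℕ.+ m) (withDescent-Unique (suc m)))
    (Uniqueₚ.++⁺ (swaps-Unique m (enumeration-Unique m)) (blocks-Unique m) swaps#blocks)
    max#rest
    where
    swaps#blocks : Disjoint (swaps m (enumeration m)) (blocks m)
    swaps#blocks (π∈swaps , π∈blocks)
      with _ , _ , refl ← ∈-map⁻ (_++ 2 ℕ.+ m ∷ suc m ∷ []) π∈swaps
         | i , r , eq , π≡ ← ∈-blocks⁻ π∈blocks = block≢swap eq (sym π≡)
    max#rest : Disjoint (map (_∷ʳ (2 ℕ.+ m)) (withDescent (suc m)))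
                        (swaps m (enumeration m) ++ blocks m)
    max#rest (π∈max , π∈rest) with ∈-map⁻ (_∷ʳ (2 ℕ.+ m)) π∈max | ∈-++⁻ (swaps m (enumeration m)) π∈rest
    ... | _ , _ , refl | inj₁ π∈swaps
      with τ , _ , eq ← ∈-map⁻ (_++ 2 ℕ.+ m ∷ suc m ∷ []) π∈swaps =
      contradiction (swap-last≡ τ (sym eq)) (<⇒≢ (n<1+n _))
    ... | _ , _ , refl | inj₂ π∈blocks
      with i , r , refl , eq ← ∈-blocks⁻ π∈blocks =
      contradiction (sym (block-last (suc i) r (sym eq))) (<⇒≢ (s≤s (s≤s (s≤s (m≤m+n i r)))))

  enumeration-Unique : ∀ n → Unique (enumeration n)
  enumeration-Unique n =
    All.tabulate (λ π∈ → λ { refl → 1‥-no-descent n (withDescent⇒HasDescent n π∈) })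
    ∷ withDescent-Unique n

-- Counting

-- Adding n+1 to f(n) = f(n-1) + f(n-2) + n - 2 turns it into the Fibonacci recursion, because (n-2)
-- + (n+1) = n + (n-1).
withDescent-count : ∀ n → suc (length (withDescent n)) ℕ.+ suc n ≡ F (2 ℕ.+ n)
withDescent-count zero          = refl
withDescent-count (suc zero)    = refl
withDescent-count (suc (suc m)) = trans (cong (λ l → suc l ℕ.+ (3 ℕ.+ m)) lengths)
  (trans (regroup (length (withDescent (suc m))) (length (withDescent m)) m)
         (cong₂ ℕ._+_ (withDescent-count (suc m)) (withDescent-count m)))
  where
  lengths : length (withDescent (2 ℕ.+ m)) ≡
    length (withDescent (suc m)) ℕ.+ (suc (length (withDescent m)) ℕ.+ m)
  lengths = trans (length-++ (map (_∷ʳ (2 ℕ.+ m)) (withDescent (suc m))))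
    (cong₂ ℕ._+_ (length-map (_∷ʳ (2 ℕ.+ m)) (withDescent (suc m)))
      (trans (length-++ (swaps m (enumeration m)))
        (cong₂ ℕ._+_ (length-map (_++ 2 ℕ.+ m ∷ suc m ∷ []) (enumeration m))
          (trans (length-map (λ i → block (suc i) (m ∸ suc i)) (upTo m)) (length-upTo m)))))
  regroup : ∀ p q m → suc (p ℕ.+ (suc q ℕ.+ m)) ℕ.+ (3 ℕ.+ m) ≡
    (suc p ℕ.+ (2 ℕ.+ m)) ℕ.+ (suc q ℕ.+ suc m)
  regroup = ℕ-solve-∀

private
  minus : ∀ a b {c} → a ℕ.+ b ≡ c → + a ≡ + c - + b
  minus a b refl = identity (+ a) (+ b)
    where
    identity : ∀ x y → x ≡ x + y - y
    identity = ℤ-solve-∀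

  minus-plus-one : ∀ a b {c} → a ℕ.+ b ≡ c → + a ≡ + c - + suc b + + 1
  -- `+ suc b` computes to `+ 1 + + b`, the form used in the identity.
  minus-plus-one a b refl = identity (+ a) (+ b)
    where
    identity : ∀ x y → x ≡ x + y - (+ 1 + y) + + 1
    identity = ℤ-solve-∀

  minus-minus-one : ∀ a b {c} → a ℕ.+ suc b ≡ c → + a ≡ + c - + b - + 1
  minus-minus-one a b refl = identity (+ a) (+ b)
    where
    identity : ∀ x y → x ≡ x + (+ 1 + y) - y - + 1
    identity = ℤ-solve-∀

-- Deleting the two last entries is a bijection onto the family of length n-2, which has F n - (n-1)
-- elements.
count-⟨1⟩ : ∀ n → 2 ≤ n → # Labelled ⟨1⟩ n ≐ + F n - + n + + 1
count-⟨1⟩ (suc zero) (s≤s ())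
count-⟨1⟩ (suc (suc m)) _ =
  swaps m (enumeration m) , swaps-Unique m (enumeration-Unique m) , (λ π → mk⇔ to from) ,
  minus-plus-one _ (suc m)
    (trans (cong (ℕ._+ suc m) (length-map _ (enumeration m))) (withDescent-count m))
  where
  to : π ∈ swaps m (enumeration m) → Labelled ⟨1⟩ (2 ℕ.+ m) π
  to π∈ with σ , σ∈ , refl ← ∈-map⁻ (_++ 2 ℕ.+ m ∷ suc m ∷ []) π∈ =
    InF-swap⁺ (enumeration⇒InF m σ∈) , s≤s (s≤s z≤n) , σ , refl
  from : Labelled ⟨1⟩ (2 ℕ.+ m) π → π ∈ swaps m (enumeration m)
  from (inF , _ , ρ , refl) =
    ∈-map⁺ (_++ 2 ℕ.+ m ∷ suc m ∷ []) (InF⇒enumeration m (InF-swap⁻ inF))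

-- The label singles out the blocks with r > 0, which end with the maximum and k = i+2 where i <
-- n-3.
count-⟨2b⟩ : ∀ n → 3 ≤ n → # Labelled ⟨2b⟩ n ≐ + n - + 3
count-⟨2b⟩ (suc zero) (s≤s ())
count-⟨2b⟩ (suc (suc zero)) (s≤s (s≤s ()))
count-⟨2b⟩ (suc (suc (suc m))) _ =
  map blockAt (upTo m) ,
  Uniqueₚ.map⁺ blockAt-injective (Uniqueₚ.upTo⁺ m) ,
  (λ π → mk⇔ to from) ,
  minus _ 3 (trans (cong (ℕ._+ 3) (trans (length-map blockAt (upTo m)) (length-upTo m))) (+-comm m 3))
  where
  blockAt : ℕ → List ℕ
  blockAt i = block (suc i) (suc (m ∸ suc i))
  blockAt-injective : ∀ {i j} → blockAt i ≡ blockAt j → i ≡ j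
  blockAt-injective {i} {j} eq = suc-injective (suc-injective (sym (block-last
    {2 ℕ.+ suc j ∷ gap (suc j) (suc (m ∸ suc j))} (suc i) (suc (m ∸ suc i)) eq)))
  to : π ∈ map blockAt (upTo m) → Labelled ⟨2b⟩ (3 ℕ.+ m) π
  to π∈ with i , i∈ , refl ← ∈-map⁻ blockAt π∈ =
    subst (λ t → InF (3 ℕ.+ t) (blockAt i)) (trans (+-suc i (m ∸ suc i)) i+r≡m)
      (InF-block i (suc (m ∸ suc i))) ,
    s≤s (s≤s (s≤s (≤-trans (s≤s z≤n) (∈-upTo⁻ i∈)))) ,
    3 ℕ.+ i ∷ gap (suc i) (m ∸ suc i) , 2 ℕ.+ i , s≤s (s≤s z≤n) , s≤s (s≤s (∈-upTo⁻ i∈)) ,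
    trans (block-suc-end (suc i) (m ∸ suc i))
      (cong (λ t → (3 ℕ.+ i ∷ gap (suc i) (m ∸ suc i)) ++ 3 ℕ.+ t ∷ 2 ℕ.+ i ∷ []) i+r≡m)
    where
    i+r≡m : suc (i ℕ.+ (m ∸ suc i)) ≡ m
    i+r≡m = m+[n∸m]≡n (∈-upTo⁻ i∈)
  blockAt-∈ : ∀ i r → suc (i ℕ.+ suc r) ≡ suc m → block (suc i) (suc r) ∈ map blockAt (upTo m)
  blockAt-∈ i r refl = subst (λ t → block (suc i) (suc t) ∈ map blockAt (upTo m))
    (trans (cong (_∸ suc i) (+-suc i r)) (m+n∸m≡n i r))
    (∈-map⁺ blockAt (∈-upTo⁺ (m<m+n i (s≤s z≤n))))
  from : Labelled ⟨2b⟩ (3 ℕ.+ m) π → π ∈ map blockAt (upTo m)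
  from (inF , _ , ρ , k , _ , k<n-1 , eq) with shape inF
  ... | max-last _ = contradiction (swap-last≡ ρ (sym eq)) (<⇒≢ (m<n⇒m<1+n k<n-1))
  ... | swap-last {σ} _ = contradiction
    (swap-last≡ σ (trans eq (sym (++-assoc ρ [ 3 ℕ.+ m ] [ k ])))) (≢-sym (<⇒≢ k<n-1))
  ... | is-block i zero refl = contradiction (proj₁ (block-zero-end i eq))
    (>⇒≢ (s≤s (s≤s (m≤n⇒m≤1+n (m≤m+n i 0)))))
  ... | is-block i (suc r) i+r≡m = blockAt-∈ i r i+r≡m

-- Only the block with r = 0 qualifies: ending with n-1 leaves a swap or this block, and in a swap n
-- stands next to last, where the label has k ≤ n-2.
count-⟨2c⟩ : ∀ n → 3 ≤ n → # Labelled ⟨2c⟩ n ≐ + 1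
count-⟨2c⟩ (suc zero) (s≤s ())
count-⟨2c⟩ (suc (suc zero)) (s≤s (s≤s ()))
count-⟨2c⟩ (suc (suc (suc m))) _ =
  [ block (suc m) 0 ] , [] ∷ [] , (λ π → mk⇔ to from) , refl
  where
  to : π ∈ [ block (suc m) 0 ] → Labelled ⟨2c⟩ (3 ℕ.+ m) π
  to (here refl) =
    subst (λ t → InF (3 ℕ.+ t) (block (suc m) 0)) (+-identityʳ m) (InF-block m 0) ,
    s≤s (s≤s (s≤s z≤n)) , [] , suc m , s≤s z≤n , ≤-refl ,
    cong (λ w → (3 ℕ.+ m ∷ w) ∷ʳ (2 ℕ.+ m)) (++-identityʳ (1‥ suc m))
  from : Labelled ⟨2c⟩ (3 ℕ.+ m) π → π ∈ [ block (suc m) 0 ]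
  from (inF , _ , ρ , suc k , _ , k<n-2 , eq)
    with shape inF | trans eq (sym (++-assoc ρ (3 ℕ.+ m ∷ 1‥ suc k) [ 2 ℕ.+ m ]))
  ... | max-last {σ} _ | eq′ =
    contradiction (∷ʳ-injectiveʳ σ (ρ ++ 3 ℕ.+ m ∷ 1‥ suc k) eq′) (>⇒≢ (n<1+n _))
  ... | is-block i r i+r≡m | eq′
    with refl ← block-last (suc i) r eq′
    with refl ← +-cancelˡ-≡ m r 0 (trans (suc-injective i+r≡m) (sym (+-identityʳ m))) = here refl
  ... | swap-last {σ} _ | eq′ = contradiction
    (∷ʳ-injectiveʳ σ (ρ ++ 3 ℕ.+ m ∷ 1‥ k)
      (trans (∷ʳ-injectiveˡ (σ ∷ʳ (3 ℕ.+ m)) _ (trans (++-assoc σ _ _) eq′))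
        (trans (cong (λ w → ρ ++ 3 ℕ.+ m ∷ w) (1‥-∷ʳ k)) (sym (++-assoc ρ (3 ℕ.+ m ∷ 1‥ k) _)))))
    (>⇒≢ (s≤s (m≤n⇒m≤1+n k<n-2)))

-- Deleting the final maximum leaves any non-identity element of length n-1. For n = 0 the label
-- would require an entry 0.
count-⟨2d⟩ : ∀ n → # Labelled ⟨2d⟩ n ≐ + F (n ℕ.+ 1) - + n - + 1
count-⟨2d⟩ zero = [] , [] , (λ π → mk⇔ (λ ()) λ { ((perm , _) , (ρ , refl) , _) →
  contradiction (proj₁ (permutation-bounds perm (∈-insert ρ))) λ () }) , refl
count-⟨2d⟩ (suc m) =
  map (_∷ʳ suc m) (withDescent m) , ∷ʳ-Unique (suc m) (withDescent-Unique m) , (λ π → mk⇔ to from) ,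
  minus-minus-one _ (suc m)
    (trans (cong (ℕ._+ (2 ℕ.+ m)) (length-map (_∷ʳ suc m) (withDescent m)))
      (trans (+-suc _ (suc m)) (trans (withDescent-count m) (cong (F ∘ suc) (+-comm 1 m)))))
  where
  to : π ∈ map (_∷ʳ suc m) (withDescent m) → Labelled ⟨2d⟩ (suc m) π
  to π∈ with σ , σ∈ , refl ← ∈-map⁻ (_∷ʳ suc m) π∈ =
    InF-∷ʳ⁺ (withDescent⇒InF m σ∈) , (σ , refl) , HasDescent-++ _ (withDescent⇒HasDescent m σ∈)
  from : Labelled ⟨2d⟩ (suc m) π → π ∈ map (_∷ʳ suc m) (withDescent m)
  from (inF , (ρ , refl) , desc) with InF⇒enumeration m (InF-∷ʳ⁻ inF)
  ... | here refl = contradiction (subst HasDescent (sym (1‥-∷ʳ m)) desc) (1‥-no-descent (suc m))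
  ... | there ρ∈  = ∈-map⁺ (_∷ʳ suc m) ρ∈

count-⟨3⟩ : ∀ n → 2 ≤ n → # Labelled ⟨3⟩ n ≐ + 1
count-⟨3⟩ n 2≤n = [ 1‥ n ] , [] ∷ [] , (λ π → mk⇔ to from) , refl
  where
  to : π ∈ [ 1‥ n ] → Labelled ⟨3⟩ n π
  to (here refl) = InF-1‥ n , 2≤n , 1‥-no-descent n
  from : Labelled ⟨3⟩ n π → π ∈ [ 1‥ n ]
  from (inF , _ , no-descent) with InF⇒enumeration n inF
  ... | here refl = here refl
  ... | there π∈  = contradiction (withDescent⇒HasDescent n π∈) no-descent

count-InF : ∀ n → # InF n ≐ + F (n ℕ.+ 2) - + n - + 1
count-InF n =
  enumeration n , enumeration-Unique n , (λ π → mk⇔ (enumeration⇒InF n) (InF⇒enumeration n)) ,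
  minus-minus-one _ n (trans (withDescent-count n) (cong F (+-comm 2 n)))

proposition7p12 : (∀ (n : ℕ) → 2 ≤ n → # Labelled ⟨1⟩ n ≐ + F n - + n + + 1) ×
    (∀ (n : ℕ) → 3 ≤ n → # Labelled ⟨2b⟩ n ≐ + n - + 3) ×
    (∀ (n : ℕ) → 3 ≤ n → # Labelled ⟨2c⟩ n ≐ + 1) ×
    (∀ (n : ℕ) → # Labelled ⟨2d⟩ n ≐ + F (n ℕ.+ 1) - + n - + 1) ×
    (∀ (n : ℕ) → 2 ≤ n → # Labelled ⟨3⟩ n ≐ + 1) ×
    (∀ (n : ℕ) → # InF n ≐ + F (n ℕ.+ 2) - + n - + 1)
proposition7p12 = count-⟨1⟩ , count-⟨2b⟩ , count-⟨2c⟩ , count-⟨2d⟩ , count-⟨3⟩ , count-InF
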